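{- For every even integer $n\geq 4$, we have $r_{\mathrm{odd}}\left(n,\frac n2+4;C_n\right)\geq 3$. That is, for every graph $G$ on $n$ vertices with minimum degree at least $\frac n2+4$, we have $r_{\mathrm{odd}}(G,C_n)\ge 3$.
   Context: Graphs are finite and simple; $v(G)$ and $\delta(G)$ denote the number of vertices and minimum degree of $G$. For graphs $G,H$, the odd-Ramsey number $r_{\mathrm{odd}}(G,H)$ is the minimum positive integer $r$ for which there is an edge-colouring of $G$ with $r$ colours (not required to be proper) such that every copy of $H$ in $G$ contains an odd number of edges of at least one colour. $C_n$ is the cycle on $n$ vertices. Define $r_{\mathrm{odd}}(n,\delta;C_n)=\min\{r_{\mathrm{odd}}(G,C_n): v(G)=n,\ \delta(G)\ge\delta\}$, where the minimum over the empty set is taken to be $+\infty$ (relevant only for $n<10$). -}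

module Defs where

open import Level using (0ℓ)
open import Data.Bool.Base using (Bool; true; false)
import Data.Bool.Properties as Bool
open import Data.Nat.Base using (ℕ; zero; suc; _+_; _*_; _≤_; _<_; _⊓_; z≤n; s≤s)
open import Data.Nat.DivMod using (_%_)
import Data.Nat.Properties as ℕ
open import Data.Fin.Base as Fin
  using (Fin; toℕ; inject₁; combine; funToFin; finToFun)
import Data.Fin.Properties as Fin
open import Data.Fin.Subset using (Subset; ∣_∣)
open import Data.List.Base
  using (List; []; _∷_; length; filter; allFin; cartesianProduct)
open import Data.List.Properties using (filter-none; filter-accept; filter-reject)
open import Data.List.Membership.Propositional using (_∈_)
open import Data.List.Membership.Propositional.Properties
  using (∈-filter⁻)
open import Data.List.Relation.Unary.All as All using (All)
open import Data.List.Relation.Unary.Any using (here; there)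
open import Data.List.Relation.Unary.AllPairs using (_∷_)
open import Data.List.Relation.Unary.Unique.Propositional using (Unique)
import Data.List.Relation.Unary.Unique.Propositional.Properties as Unique
import Data.Vec.Base as Vec
open import Data.Vec.Properties using (tabulate-cong)
import Data.Vec.Functional as Vector
open import Data.Product.Base using (∃; ∃-syntax; _×_; _,_; proj₁; proj₂; map₂)
open import Data.Sum.Base using (_⊎_; inj₁; inj₂; swap)
open import Function.Base using (_∘_)
open import Function.Bundles using (Inverse)
open import Function.Definitions using (Injective)
open import Relation.Nullary using (¬_; Dec; does; yes; no; contradiction)
open import Relation.Nullary.Decidable
  using (map′; _×-dec_; _⊎-dec_; _→-dec_; ¬?; dec-true; dec-false)
open import Relation.Nullary.Construct.Add.Supremum using (_⁺; ⊤⁺; [_])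
open import Relation.Unary using (Pred; Decidable)
open import Relation.Binary.PropositionalEquality
import Relation.Binary.Construct.Add.Supremum.NonStrict as Supremum

-- ℕ∞, with ⊤⁺ playing the role of +∞.

ℕ∞ : Set
ℕ∞ = ℕ ⁺

open Supremum _≤_ public using () renaming (_≤⁺_ to _≤∞_)

-- The minimum of a set of natural numbers, with min ∅ = +∞.

infix 4 _IsMinOf_

_IsMinOf_ : ℕ∞ → Pred ℕ 0ℓ → Set
[ k ] IsMinOf P = P k × (∀ j → P j → k ≤ j)
⊤⁺    IsMinOf P = ∀ j → ¬ P j

record Graph (n : ℕ) : Set where
  field
    adj    : Fin n → Fin n → Bool
    symm   : ∀ {u v} → adj u v ≡ true → adj v u ≡ true
    irrefl : ∀ v → adj v v ≡ false

open Graph public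

module _ {n} (G : Graph n) where

  neighbours : Fin n → Subset n
  neighbours v = Vec.tabulate (adj G v)

  degree : Fin n → ℕ
  degree v = ∣ neighbours v ∣

  -- All degrees are at most n, so the base value n does not affect the
  -- minimum as soon as there is a vertex.
  δ : ℕ
  δ = Vector.foldr _⊓_ n degree

  -- Each edge occurs once, as its pair (u , v) with u < v.
  edge? : Decidable (λ ((u , v) : Fin n × Fin n) → u Fin.< v × adj G u v ≡ true)
  edge? (u , v) = (u Fin.<? v) ×-dec (adj G u v Bool.≟ true)

  edges : List (Fin n × Fin n)
  edges = filter edge? (cartesianProduct (allFin n) (allFin n))

-- v is the vertex after u in the cyclic order 0, 1, …, n-1, 0.

Next : ∀ {n} → Fin n → Fin n → Set
Next {n} u v = toℕ v ≡ suc (toℕ u) ⊎ (suc (toℕ u) ≡ n × toℕ v ≡ 0)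

next? : ∀ {n} (u v : Fin n) → Dec (Next u v)
next? {n} u v = (toℕ v ℕ.≟ suc (toℕ u)) ⊎-dec ((suc (toℕ u) ℕ.≟ n) ×-dec (toℕ v ℕ.≟ 0))

-- The condition u ≢ v only matters for n = 1, where it removes the loop.

CycleAdj : ∀ {n} → Fin n → Fin n → Set
CycleAdj u v = u ≢ v × (Next u v ⊎ Next v u)

cycleAdj? : ∀ {n} (u v : Fin n) → Dec (CycleAdj u v)
cycleAdj? u v = ¬? (u Fin.≟ v) ×-dec (next? u v ⊎-dec next? v u)

private

  does-true : ∀ {P : Set} (P? : Dec P) → does P? ≡ true → P
  does-true (yes p) _ = p

C : ∀ n → Graph n
C n .adj u v = does (cycleAdj? u v)
C n .symm {u} {v} p =
  let u≢v , q = does-true (cycleAdj? u v) p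
  in dec-true (cycleAdj? v u) (u≢v ∘ sym , swap q)
C n .irrefl v = dec-false (cycleAdj? v v) (λ (v≢v , _) → v≢v refl)

-- A copy of H in G is the image of an injective homomorphism H → G.

IsCopy : ∀ {m n} → Graph m → Graph n → (Fin m → Fin n) → Set
IsCopy H G φ =
  Injective _≡_ _≡_ φ × (∀ {a b} → adj H a b ≡ true → adj G (φ a) (φ b) ≡ true)

-- Colourings are total on pairs of vertices; only the values at edges of the
-- graph under consideration are ever inspected.

record Colouring (n r : ℕ) : Set where
  field
    colour : Fin n → Fin n → Fin r
    symm   : ∀ u v → colour u v ≡ colour v u

open Colouring public using (colour)

colourCount : ∀ {m n r} → Graph m → (Fin m → Fin n) → (Fin n → Fin n → Fin r) → Fin r → ℕ
colourCount H φ c i = length (filter (λ (a , b) → c (φ a) (φ b) Fin.≟ i) (edges H))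

OddOnCopies : ∀ {m n r} → Graph n → Graph m → (Fin n → Fin n → Fin r) → Set
OddOnCopies G H c = ∀ φ → IsCopy H G φ → ∃[ i ] colourCount H φ c i % 2 ≡ 1

HasOddColouring : ∀ {m n} → Graph n → Graph m → Pred ℕ 0ℓ
HasOddColouring {n = n} G H r = 1 ≤ r × ∃[ χ ] OddOnCopies G H (colour {n} {r} χ)

-- The minimum of a decidable set exists constructively once some bound
-- on its least element is known.

private

  least : ∀ {P : Pred ℕ 0ℓ} → Decidable P → ∀ b →
          (∃[ k ] [ k ] IsMinOf P) ⊎ (∀ j → j < b → ¬ P j)
  least P? zero = inj₂ λ _ ()
  least {P} P? (suc b) with least P? b
  ... | inj₁ found = inj₁ found
  ... | inj₂ none with P? b
  ...   | yes Pb = inj₁ (b , Pb , λ j Pj → ℕ.≮⇒≥ λ j<b → none j j<b Pj)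
  ...   | no ¬Pb = inj₂ go
    where
    go : ∀ j → j < suc b → ¬ P j
    go j j<1+b Pj with ℕ.m<1+n⇒m<n∨m≡n j<1+b
    ... | inj₁ j<b  = none j j<b Pj
    ... | inj₂ refl = ¬Pb Pj

  minimum : ∀ {P : Pred ℕ 0ℓ} → Decidable P →
            ∀ b → (∀ {r} → P r → ∃[ s ] s ≤ b × P s) → ∃[ x ] x IsMinOf P
  minimum P? b bound with least P? (suc b)
  ... | inj₁ (k , isMin) = [ k ] , isMin
  ... | inj₂ none        = ⊤⁺ , λ _ Pj → let s , s≤b , Ps = bound Pj in none s (s≤s s≤b) Ps

  anyFun? : ∀ {n k} {P : Pred (Fin n → Fin k) 0ℓ} → (∀ {f g} → f ≗ g → P f → P g) →
            Decidable P → Dec (∃ P)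
  anyFun? resp P? =
    map′ (λ (i , p) → finToFun i , p)
         (λ (f , p) → funToFin f , resp (λ x → sym (Fin.finToFun-funToFin f x)) p)
         (Fin.any? (P? ∘ finToFun))

  allFun? : ∀ {n k} {P : Pred (Fin n → Fin k) 0ℓ} → (∀ {f g} → f ≗ g → P f → P g) →
            Decidable P → Dec (∀ f → P f)
  allFun? resp P? =
    map′ (λ h f → resp (Fin.finToFun-funToFin f) (h (funToFin f)))
         (λ h i → h (finToFun i))
         (Fin.all? (P? ∘ finToFun))

  anyFun₂? : ∀ {n k} {P : Pred (Fin n → Fin n → Fin k) 0ℓ} →
             (∀ {f g} → (∀ u v → f u v ≡ g u v) → P f → P g) →
             Decidable P → Dec (∃ P)
  anyFun₂? {n} {k} {P} resp P? =
    map′ (λ (f , p) → finToFun ∘ f , p)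
         (λ (f , p) → funToFin ∘ f , resp (λ u v → sym (Fin.finToFun-funToFin (f u) v)) p)
         (anyFun? {P = λ f → P (finToFun ∘ f)}
                  (λ f≗g → resp (λ u v → cong (λ i → finToFun i v) (f≗g u)))
                  (λ f → P? (finToFun ∘ f)))

  isCopy? : ∀ {m n} (H : Graph m) (G : Graph n) φ → Dec (IsCopy H G φ)
  isCopy? H G φ =
    map′ (λ h {a} {b} → h a b) (λ h a b → h {a} {b})
         (Fin.all? λ a → Fin.all? λ b → (φ a Fin.≟ φ b) →-dec (a Fin.≟ b))
    ×-dec
    map′ (λ h {a} {b} → h a b) (λ h a b → h {a} {b})
         (Fin.all? λ a → Fin.all? λ b →
            (adj H a b Bool.≟ true) →-dec (adj G (φ a) (φ b) Bool.≟ true))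

  isCopy-resp : ∀ {m n} (H : Graph m) (G : Graph n) {φ ψ} → φ ≗ ψ →
                IsCopy H G φ → IsCopy H G ψ
  isCopy-resp H G e (inj , hom) =
    (λ {a} {b} p → inj (trans (e a) (trans p (sym (e b))))) ,
    (λ {a} {b} p → trans (cong₂ (adj G) (sym (e a)) (sym (e b))) (hom p))

  length-filter-cong : ∀ {A : Set} {P Q : Pred A 0ℓ} (P? : Decidable P) (Q? : Decidable Q) →
                       (∀ x → does (P? x) ≡ does (Q? x)) →
                       ∀ xs → length (filter P? xs) ≡ length (filter Q? xs)
  length-filter-cong P? Q? h [] = refl
  length-filter-cong P? Q? h (x ∷ xs) with does (P? x) | does (Q? x) | h x
  ... | true  | true  | refl = cong suc (length-filter-cong P? Q? h xs)
  ... | false | false | refl = length-filter-cong P? Q? h xs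

  colourCount-cong : ∀ {m n r} (H : Graph m) {φ ψ : Fin m → Fin n}
                     {c d : Fin n → Fin n → Fin r} → (∀ a b → c (φ a) (φ b) ≡ d (ψ a) (ψ b)) →
                     ∀ i → colourCount H φ c i ≡ colourCount H ψ d i
  colourCount-cong H e i =
    length-filter-cong _ _ (λ (a , b) → cong (λ j → does (j Fin.≟ i)) (e a b)) (edges H)

  oddOnCopies? : ∀ {m n r} (G : Graph n) (H : Graph m) (c : Fin n → Fin n → Fin r) →
                 Dec (OddOnCopies G H c)
  oddOnCopies? G H c = allFun?
    (λ {φ} {ψ} e h copy →
      map₂ (λ {i} → trans (cong (_% 2)
             (sym (colourCount-cong H {c = c} {d = c} (λ a b → cong₂ c (e a) (e b)) i))))
           (h (isCopy-resp H G (sym ∘ e) copy)))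
    (λ φ → isCopy? H G φ →-dec Fin.any? λ i → colourCount H φ c i % 2 ℕ.≟ 1)

  oddOnCopies-resp : ∀ {m n r} (G : Graph n) (H : Graph m) {c d : Fin n → Fin n → Fin r} →
                     (∀ u v → c u v ≡ d u v) → OddOnCopies G H c → OddOnCopies G H d
  oddOnCopies-resp G H {c} {d} e h φ copy =
    map₂ (λ {i} → trans (cong (_% 2)
           (sym (colourCount-cong H {φ = φ} {ψ = φ} {c} {d} (λ a b → e (φ a) (φ b)) i))))
         (h φ copy)

  hasOddColouring? : ∀ {m n} (G : Graph n) (H : Graph m) → Decidable (HasOddColouring G H)
  hasOddColouring? G H r = (1 ℕ.≤? r) ×-dec map′
    (λ (c , s , h) → record { colour = c ; symm = s } , h)
    (λ (χ , h) → colour χ , Colouring.symm χ , h)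
    (anyFun₂?
      (λ e (s , h) → (λ u v → trans (sym (e u v)) (trans (s u v) (e v u))) ,
                     oddOnCopies-resp G H e h)
      (λ c → Fin.all? (λ u → Fin.all? λ v → c u v Fin.≟ c v u) ×-dec oddOnCopies? G H c))

  -- If some odd colouring exists, then colouring every pair of vertices
  -- differently also gives one, with 1 + n * n available colours.

  fmin fmax : ∀ {n} → Fin n → Fin n → Fin n
  fmin u v with u Fin.<? v
  ... | yes _ = u
  ... | no  _ = v
  fmax u v with u Fin.<? v
  ... | yes _ = v
  ... | no  _ = u

  minmax-comm : ∀ {n} (u v : Fin n) → fmin u v ≡ fmin v u × fmax u v ≡ fmax v u
  minmax-comm u v with u Fin.<? v | v Fin.<? u
  ... | yes p | yes q = contradiction q (ℕ.<-asym p)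
  ... | yes _ | no  _ = refl , refl
  ... | no  _ | yes _ = refl , refl
  ... | no  p | no  q = eq , sym eq
    where eq = Fin.toℕ-injective (ℕ.≤-antisym (ℕ.≮⇒≥ p) (ℕ.≮⇒≥ q))

  minmax-inj : ∀ {n} {u v x y : Fin n} → fmin u v ≡ fmin x y → fmax u v ≡ fmax x y →
               (u ≡ x × v ≡ y) ⊎ (u ≡ y × v ≡ x)
  minmax-inj {u = u} {v} {x} {y} p q with u Fin.<? v | x Fin.<? y
  ... | yes _ | yes _ = inj₁ (p , q)
  ... | yes _ | no  _ = inj₂ (p , q)
  ... | no  _ | yes _ = inj₂ (q , p)
  ... | no  _ | no  _ = inj₁ (q , p)

  rainbow : ∀ n → Colouring n (suc (n * n))
  rainbow n = record
    { colour = λ u v → inject₁ (combine (fmin u v) (fmax u v))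
    ; symm   = λ u v → let p , q = minmax-comm u v in cong₂ (λ x y → inject₁ (combine x y)) p q
    }

  rainbow-inj : ∀ {n} {u v x y : Fin n} → colour (rainbow n) u v ≡ colour (rainbow n) x y →
                (u ≡ x × v ≡ y) ⊎ (u ≡ y × v ≡ x)
  rainbow-inj e = let p , q = Fin.combine-injective _ _ _ _ (Fin.inject₁-injective e)
                  in minmax-inj p q

  filter-singleton : ∀ {A : Set} {P : Pred A 0ℓ} (P? : Decidable P) {x} {xs : List A} →
                     Unique xs → x ∈ xs → P x → (∀ {y} → y ∈ xs → P y → y ≡ x) →
                     length (filter P? xs) ≡ 1
  filter-singleton P? {xs = x ∷ xs} (x∉ ∷ _) (here refl) Px only
    rewrite filter-accept P? {xs = xs} Px
          | filter-none P? (All.tabulate {xs = xs} λ y∈ Py →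
              All.lookup x∉ y∈ (sym (only (there y∈) Py))) = refl
  filter-singleton P? {x} {z ∷ xs} (z∉ ∷ uniq) (there x∈) Px only
    rewrite filter-reject P? {xs = xs} (λ Pz → All.lookup z∉ x∈ (only (here refl) Pz))
    = filter-singleton P? uniq x∈ Px (only ∘ there)

  edges-unique : ∀ {n} (G : Graph n) → Unique (edges G)
  edges-unique {n} G = Unique.filter⁺ (edge? G)
    (Unique.cartesianProduct⁺ (Unique.allFin⁺ n) (Unique.allFin⁺ n))

  rainbow-odd : ∀ {m n} (H : Graph m) (φ : Fin m → Fin n) → Injective _≡_ _≡_ φ →
                ∀ {e} → e ∈ edges H →
                ∃[ i ] colourCount H φ (colour (rainbow n)) i % 2 ≡ 1
  rainbow-odd {m} {n} H φ inj {a , b} e∈ = colour (rainbow n) (φ a) (φ b) ,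
    cong (_% 2) (filter-singleton (λ (x , y) → _ Fin.≟ _) (edges-unique H) e∈ refl only)
    where
    ordered : ∀ {x y} → (x , y) ∈ edges H → x Fin.< y
    ordered f∈ = proj₁ (proj₂ (∈-filter⁻ (edge? H)
                   {xs = cartesianProduct (allFin m) (allFin m)} f∈))

    only : ∀ {f} → f ∈ edges H →
           colour (rainbow n) (φ (proj₁ f)) (φ (proj₂ f)) ≡ colour (rainbow n) (φ a) (φ b) →
           f ≡ (a , b)
    only f∈ eq with rainbow-inj eq
    ... | inj₁ (p , q) = cong₂ _,_ (inj p) (inj q)
    ... | inj₂ (p , q) with inj p | inj q
    ...   | refl | refl = contradiction (ordered f∈) (ℕ.<-asym (ordered e∈))

  hasOddColouring-bound : ∀ {m n} (G : Graph n) (H : Graph m) {r} →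
                          HasOddColouring G H r → HasOddColouring G H (suc (n * n))
  hasOddColouring-bound {n = n} G H (_ , χ , h) = s≤s z≤n , rainbow n , odd
    where
    nonempty : ∀ {A : Set} {P : Pred A 0ℓ} (P? : Decidable P) xs →
               length (filter P? xs) % 2 ≡ 1 → ∃[ x ] x ∈ xs
    nonempty P? (x ∷ xs) _ = x , here refl

    odd : OddOnCopies G H (colour (rainbow n))
    odd φ copy with h φ copy
    ... | i , p = rainbow-odd H φ (proj₁ copy) (proj₂ (nonempty _ (edges H) p))

  rOdd-exists : ∀ {m n} (G : Graph n) (H : Graph m) → ∃[ x ] x IsMinOf HasOddColouring G H
  rOdd-exists {n = n} G H = minimum (hasOddColouring? G H) (suc (n * n))
    (λ p → _ , ℕ.≤-refl , hasOddColouring-bound G H p)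

-- rOdd G H is r_odd(G,H).  By the bound above it is +∞ only if G contains a
-- copy of H and H has no edges, when no number of colours works.

rOdd : ∀ {m n} → Graph n → Graph m → ℕ∞
rOdd G H = proj₁ (rOdd-exists G H)

rOdd-isMin : ∀ {m n} (G : Graph n) (H : Graph m) → rOdd G H IsMinOf HasOddColouring G H
rOdd-isMin G H = proj₂ (rOdd-exists G H)

RealisedWithMinDegree : ∀ {m} (n d : ℕ) → Graph m → Pred ℕ 0ℓ
RealisedWithMinDegree n d H r = ∃[ G ] d ≤ δ {n} G × rOdd G H ≡ [ r ]

private

  IsMinOf-unique : ∀ {P x y} → x IsMinOf P → y IsMinOf P → x ≡ y
  IsMinOf-unique {x = [ _ ]} {[ _ ]} (p , f) (q , g) = cong [_] (ℕ.≤-antisym (f _ q) (g _ p))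
  IsMinOf-unique {x = [ _ ]} {⊤⁺}    (p , _) g       = contradiction p (g _)
  IsMinOf-unique {x = ⊤⁺}    {[ _ ]} f       (q , _) = contradiction q (f _)
  IsMinOf-unique {x = ⊤⁺}    {⊤⁺}    _       _       = refl

  infix 4 _≈_

  _≈_ : ∀ {n} → Graph n → Graph n → Set
  G ≈ G′ = ∀ u v → adj G u v ≡ adj G′ u v

  hasOddColouring-resp : ∀ {m n} {G G′ : Graph n} (H : Graph m) {r} → G ≈ G′ →
                         HasOddColouring G H r → HasOddColouring G′ H r
  hasOddColouring-resp H e (r≥1 , χ , h) =
    r≥1 , χ , λ φ (inj , hom) → h φ (inj , λ {a} {b} p → trans (e (φ a) (φ b)) (hom p))

  IsMinOf-resp : ∀ {P Q : Pred ℕ 0ℓ} → (∀ {r} → P r → Q r) → (∀ {r} → Q r → P r) →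
                 ∀ {x} → x IsMinOf P → x IsMinOf Q
  IsMinOf-resp to from {[ _ ]} (p , f) = to p , λ j q → f j (from q)
  IsMinOf-resp to from {⊤⁺}    f       = λ j q → f j (from q)

  rOdd-cong : ∀ {m n} {G G′ : Graph n} (H : Graph m) → G ≈ G′ → rOdd G H ≡ rOdd G′ H
  rOdd-cong {G = G} {G′} H e = IsMinOf-unique
    (IsMinOf-resp (hasOddColouring-resp {G = G} {G′} H e)
                  (hasOddColouring-resp {G = G′} {G} H (λ u v → sym (e u v)))
                  (rOdd-isMin G H))
    (rOdd-isMin G′ H)

  δ-cong : ∀ {n} {G G′ : Graph n} → G ≈ G′ → δ G ≡ δ G′
  δ-cong {n} e = foldr-cong λ v → cong ∣_∣ (tabulate-cong (e v))
    where
    foldr-cong : ∀ {k} {f g : Fin k → ℕ} → f ≗ g →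
                 Vector.foldr _⊓_ n f ≡ Vector.foldr _⊓_ n g
    foldr-cong {zero}  _ = refl
    foldr-cong {suc _} e = cong₂ _⊓_ (e Fin.zero) (foldr-cong (e ∘ Fin.suc))

  anyGraph? : ∀ {n} {P : Pred (Graph n) 0ℓ} → (∀ {G G′} → G ≈ G′ → P G → P G′) →
              Decidable P → Dec (∃ P)
  anyGraph? {n} {P} resp P? = map′
    (λ (_ , G , _ , p) → G , p)
    (λ (G , p) → (λ u v → encode (adj G u v)) , G ,
                 (λ u v → sym (decode-encode (adj G u v))) , p)
    (anyFun₂? {P = λ f → ∃[ G ] (∀ u v → adj G u v ≡ decode (f u v)) × P G}
      (λ e (G , q , p) → G , (λ u v → trans (q u v) (cong decode (e u v))) , p)
      dec)
    where
    open Inverse Fin.2↔Bool renaming (to to decode; from to encode; strictlyInverseˡ to decode-encode)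

    dec : ∀ f → Dec (∃[ G ] (∀ u v → adj G u v ≡ decode (f u v)) × P G)
    dec f with Fin.all? (λ u → Fin.all? λ v →
                 (decode (f u v) Bool.≟ true) →-dec (decode (f v u) Bool.≟ true))
             | Fin.all? (λ v → decode (f v v) Bool.≟ false)
    ... | no ¬s | _     = no λ (G , q , _) →
      ¬s λ u v p → trans (sym (q v u)) (symm G (trans (q u v) p))
    ... | yes _ | no ¬i = no λ (G , q , _) → ¬i λ v → trans (sym (q v v)) (irrefl G v)
    ... | yes s | yes i = map′ (λ p → G₀ , (λ _ _ → refl) , p)
                               (λ (G , q , p) → resp {G} {G₀} q p)
                               (P? G₀)
      where
      G₀ : Graph n
      G₀ = record { adj = λ u v → decode (f u v) ; symm = λ {u} {v} → s u v ; irrefl = i }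

  [≡]? : (x : ℕ∞) (r : ℕ) → Dec (x ≡ [ r ])
  [≡]? [ k ] r = map′ (cong [_]) (λ { refl → refl }) (k ℕ.≟ r)
  [≡]? ⊤⁺    r = no λ ()

  rOddMin-exists : ∀ {m} (n d : ℕ) (H : Graph m) →
                   ∃[ x ] x IsMinOf RealisedWithMinDegree n d H
  rOddMin-exists n d H = minimum
    (λ r → anyGraph?
      (λ {G} {G′} e (p , q) → subst (d ≤_) (δ-cong {G = G} {G′} e) p ,
                              trans (sym (rOdd-cong {G = G} {G′} H e)) q)
      (λ G → (d ℕ.≤? δ G) ×-dec [≡]? (rOdd G H) r))
    (suc (n * n))
    (λ {r} (G , p , q) →
      let isMin = subst (_IsMinOf HasOddColouring G H) q (rOdd-isMin G H)
      in r , proj₂ isMin _ (hasOddColouring-bound G H (proj₁ isMin)) , G , p , q)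

-- min { r_odd(G,H) : v(G) = n , δ(G) ≥ d }; graphs with r_odd(G,H) = +∞ do
-- not affect it, so ranging over the finite values suffices.

rOddMin : ∀ {m} (n d : ℕ) → Graph m → ℕ∞
rOddMin n d H = proj₁ (rOddMin-exists n d H)

rOddMin-isMin : ∀ {m} (n d : ℕ) (H : Graph m) →
                rOddMin n d H IsMinOf RealisedWithMinDegree n d H
rOddMin-isMin n d H = proj₂ (rOddMin-exists n d H)

{-# OPTIONS --safe #-}
module Submission where

-- Colour 0 gives a 0/1 weight on edges; as n is even, with at most two colours
-- an odd colouring makes every Hamilton cycle odd.  If u x v y w z is a hexagon,
-- join its opposite vertices by disjoint paths: u s y and x t w through common
-- neighbours, and a path from v to z through all remaining vertices.  Together
-- with either perfect matching of the hexagon these paths form a Hamilton cycle,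
-- and the two cycles differ exactly in the hexagon's edges, so every hexagon is
-- even.  As any two vertices have 8 common neighbours, two hexagons sharing a
-- path v y w z u show that the weight of a path u x v depends only on u and v,
-- and the hexagons then make this function of (u , v) additive.  Hence all closed
-- walks of even length are even, in particular some Hamilton cycle, a contradiction.

open import Defs
open import Data.Bool.Base using (Bool; true; false; _∧_; _xor_; not)
import Data.Bool.Properties as Bool
open import Data.Bool.Solver using (module xor-∧-Solver)
open import Data.Empty using (⊥)
open import Data.Fin.Base as Fin using (Fin; toℕ; fromℕ; inject₁)
import Data.Fin.Properties as Fin
open import Data.Fin.Subset using (∣_∣)
open import Data.List.Base
  using (List; []; _∷_; _++_; _ʳ++_; length; filter; allFin; tabulate; lookup; cartesianProduct)
open import Data.List.Membership.Propositional using (_∈_)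
open import Data.List.Membership.Propositional.Properties
  using (∈-∃++; ∈-filter⁻; ∈-filter⁺; ∈-allFin; ∈-tabulate⁺; ∈-tabulate⁻; ∈-cartesianProduct⁺)
open import Data.List.Membership.Propositional.Properties.WithK using (unique∧set⇒bag)
import Data.List.Membership.DecPropositional as DecMembership
open import Data.List.Properties
  using (++-assoc; ++-identityʳ; length-++; filter-++; length-tabulate; tabulate-lookup)
open import Data.List.Relation.Binary.BagAndSetEquality using (∼bag⇒↭)
open import Data.List.Relation.Binary.Permutation.Propositional
  using (_↭_; ↭-refl; ↭-sym; ↭-trans; ↭-prep; ↭-reflexive; ↭⇒↭ₛ)
open import Data.List.Relation.Binary.Permutation.Propositional.Properties
  using (shift; ++⁺ʳ; ++⁺ˡ; ++-comm; shifts; ++↭ʳ++; ↭-length; filter-↭; ∈-resp-↭)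
import Data.List.Relation.Binary.Permutation.Setoid.Properties as Permutationₛ
open import Data.List.Relation.Binary.Subset.Propositional using (_⊆_)
open import Data.List.Relation.Unary.All as All using (All; []; _∷_)
open import Data.List.Relation.Unary.All.Properties using (¬Any⇒All¬; tabulate⁺; tabulate⁻)
open import Data.List.Relation.Unary.AllPairs using ([]; _∷_)
open import Data.List.Relation.Unary.Any using (here; there)
open import Data.List.Relation.Unary.Unique.Propositional using (Unique)
import Data.List.Relation.Unary.Unique.Propositional.Properties as Unique
open import Data.Nat.Base using (ℕ; zero; suc; _+_; _*_; _≤_; _<_; _⊓_; z≤n; s≤s; s≤s⁻¹)
open import Data.Nat.DivMod using (_/_; _%_; m*n/n≡m)
open import Data.Nat.Divisibility using (_∣_; divides)
import Data.Nat.Properties as ℕ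
open import Data.Nat.Solver using (module +-*-Solver)
open import Data.Product.Base using (∃-syntax; _×_; _,_; proj₁; proj₂)
open import Data.Sum.Base using (_⊎_; inj₁; inj₂)
open import Data.Unit.Base using (⊤)
import Data.Vec.Base as Vec
import Data.Vec.Functional as Vector
open import Function.Base using (_∘_)
open import Function.Bundles using (mk⇔)
open import Level using (0ℓ)
import Relation.Binary.Construct.Add.Supremum.NonStrict as Supremum
open import Relation.Binary.PropositionalEquality
  using (_≡_; _≢_; refl; sym; trans; cong; cong₂; subst; setoid; module ≡-Reasoning)
open import Relation.Nullary using (¬_; Dec; does; yes; no; contradiction)
open import Relation.Nullary.Construct.Add.Supremum using (⊤⁺; [_])
open import Relation.Nullary.Decidable using (_×-dec_; ¬?; dec-true)
open import Relation.Unary using (Pred; Decidable)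

private
  variable
    A : Set

-- Lists, counting and walks.

Unique-resp-↭ : ∀ {xs ys : List A} → xs ↭ ys → Unique xs → Unique ys
Unique-resp-↭ eq = Permutationₛ.Unique-resp-↭ (setoid _) (↭⇒↭ₛ eq)

ind : Bool → ℕ
ind false = 0
ind true  = 1

count : (A → Bool) → List A → ℕ
count p xs = length (filter (λ x → p x Bool.≟ true) xs)

count-∷ : ∀ (p : A → Bool) x xs → count p (x ∷ xs) ≡ ind (p x) + count p xs
count-∷ p x xs with p x
... | false = refl
... | true  = refl

count-++ : ∀ (p : A → Bool) xs ys → count p (xs ++ ys) ≡ count p xs + count p ys
count-++ p xs ys = trans (cong length (filter-++ (λ x → p x Bool.≟ true) xs ys))
                         (length-++ (filter (λ x → p x Bool.≟ true) xs))

count-↭ : ∀ (p : A → Bool) {xs ys} → xs ↭ ys → count p xs ≡ count p ys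
count-↭ p eq = ↭-length (filter-↭ (λ x → p x Bool.≟ true) eq)

count≤length : ∀ (p : A → Bool) xs → count p xs ≤ length xs
count≤length p []       = z≤n
count≤length p (x ∷ xs) with p x
... | false = ℕ.m≤n⇒m≤1+n (count≤length p xs)
... | true  = s≤s (count≤length p xs)

-- Inclusion-exclusion, with the union bounded by all of `xs`.
count-∧ : ∀ (p q : A → Bool) xs →
          count p xs + count q xs ≤ length xs + count (λ x → p x ∧ q x) xs
count-∧ p q []       = z≤n
count-∧ p q (x ∷ xs) with p x | q x | count-∧ p q xs
... | false | false | ih = ℕ.m≤n⇒m≤1+n ih
... | false | true  | ih = ℕ.≤-trans (ℕ.≤-reflexive (ℕ.+-suc _ _)) (s≤s ih)
... | true  | false | ih = s≤s ih
... | true  | true  | ih = s≤s (ℕ.≤-trans (ℕ.≤-reflexive (ℕ.+-suc _ _))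
                             (ℕ.≤-trans (s≤s ih) (ℕ.≤-reflexive (sym (ℕ.+-suc _ _)))))

-- Supplies complements of vertex lists and, through lengths, the pigeonhole bound in
-- `common-neighbour`.
unique-⊆⇒↭ : ∀ {xs ys : List A} → Unique xs → xs ⊆ ys → ∃[ zs ] xs ++ zs ↭ ys
unique-⊆⇒↭ {xs = []}     {ys} _           _   = ys , ↭-refl
unique-⊆⇒↭ {xs = x ∷ xs} (x∉ ∷ uniq) sub with ∈-∃++ (sub (here refl))
... | as , bs , refl with unique-⊆⇒↭ uniq sub′
  where
  sub′ : xs ⊆ as ++ bs
  sub′ y∈ with ∈-resp-↭ (shift x as bs) (sub (there y∈))
  ... | here y≡x  = contradiction (sym y≡x) (All.lookup x∉ y∈)
  ... | there y∈′ = y∈′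
... | zs , eq = zs , ↭-trans (↭-prep x eq) (↭-sym (shift x as bs))

-- Vertices may repeat, so these are walks. Where paths or cycles are meant, a permutation to a
-- repetition-free list rules repetition out.
data Path (R : A → A → Set) : A → A → List A → Set where
  stop : ∀ {x} → Path R x x (x ∷ [])
  step : ∀ {x y z xs} → R x y → Path R y z xs → Path R x z (x ∷ xs)

path-++ : ∀ {R : A → A → Set} {u v w z xs ys} →
          Path R u v xs → R v w → Path R w z ys → Path R u z (xs ++ ys)
path-++ stop       r q = step r q
path-++ (step s p) r q = step s (path-++ p r q)

-- A rotation: `_ʳ++_` reverses its first list onto the second, so the walk starts at `v`, runs back
-- to `u` and leaves over the edge to `w`.
path-ʳ++ : ∀ {R : A → A → Set} → (∀ {x y} → R x y → R y x) → ∀ {u v w z xs ys} →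
           Path R u v xs → R u w → Path R w z ys → Path R v z (xs ʳ++ ys)
path-ʳ++ s stop       r q = step r q
path-ʳ++ s (step t p) r q = path-ʳ++ s p (s t) (step r q)

-- Hamilton paths with prescribed ends in dense graphs.

both-or-≤1 : ∀ a b → (a ≡ true × b ≡ true) ⊎ ind a + ind b ≤ 1
both-or-≤1 true  true  = inj₁ (refl , refl)
both-or-≤1 false false = inj₂ z≤n
both-or-≤1 false true  = inj₂ ℕ.≤-refl
both-or-≤1 true  false = inj₂ ℕ.≤-refl

Crossing : (A → A → Set) → (A → Bool) → (A → Bool) → A → A → List A → Set
Crossing R p q u z xs =
  ∃[ v ] ∃[ w ] ∃[ ys ] ∃[ zs ]
    ys ++ zs ≡ xs × Path R u v ys × Path R w z zs × p v ≡ true × q w ≡ true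

-- Compares `p` with `q` shifted by one place. Without a crossing, each pair of consecutive vertices
-- contributes at most 1; left over are `p` at the last vertex, again at most 1, and `q` at the
-- first, which is the term `ind (q u)`.
crossing : ∀ {R : A → A → Set} (p q : A → Bool) {u z xs} → Path R u z xs →
           Crossing R p q u z xs ⊎ count p xs + count q xs ≤ length xs + ind (q u)
crossing p q {u} stop with p u | q u
... | false | false = inj₂ z≤n
... | false | true  = inj₂ (s≤s z≤n)
... | true  | false = inj₂ (s≤s z≤n)
... | true  | true  = inj₂ (s≤s (s≤s z≤n))
crossing p q {u} (step {y = w} {xs = xs} r path) with crossing p q path
... | inj₁ (a , b , ys , zs , refl , l , m , pa , qb) =
      inj₁ (a , b , u ∷ ys , zs , refl , step r l , m , pa , qb)
-- The new front pair `u`, `w` is a crossing, or its contribution `ind (p u) + ind (q w)` is at most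
-- 1 and pays for the extra unit of length.
... | inj₂ h with both-or-≤1 (p u) (q w)
... | inj₁ (pu , qw) = inj₁ (u , w , u ∷ [] , xs , refl , stop , path , pu , qw)
... | inj₂ ≤1 = inj₂ (begin
    count p (u ∷ xs) + count q (u ∷ xs)
      ≡⟨ cong₂ _+_ (count-∷ p u xs) (count-∷ q u xs) ⟩
    (ind (p u) + count p xs) + (ind (q u) + count q xs)
      ≡⟨ solve 4 (λ a b c d → (a :+ b) :+ (c :+ d) := (b :+ d) :+ (a :+ c)) refl
           (ind (p u)) (count p xs) (ind (q u)) (count q xs) ⟩
    (count p xs + count q xs) + (ind (p u) + ind (q u))
      ≤⟨ ℕ.+-monoˡ-≤ (ind (p u) + ind (q u)) h ⟩
    (length xs + ind (q w)) + (ind (p u) + ind (q u))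
      ≡⟨ solve 4 (λ a b c d → (a :+ b) :+ (c :+ d) := (c :+ b) :+ (a :+ d)) refl
           (length xs) (ind (q w)) (ind (p u)) (ind (q u)) ⟩
    (ind (p u) + ind (q w)) + (length xs + ind (q u))
      ≤⟨ ℕ.+-monoˡ-≤ (length xs + ind (q u)) ≤1 ⟩
    suc (length xs) + ind (q u) ∎)
  where
  open ℕ.≤-Reasoning
  open +-*-Solver

module Hamiltonian (e : A → A → Bool)
                   (e-sym : ∀ {u v} → e u v ≡ true → e v u ≡ true)
                   (e-irrefl : ∀ v → e v v ≡ false) where

  E : A → A → Set
  E u v = e u v ≡ true

  Anything : A → A → Set
  Anything _ _ = ⊤

  -- Ore's degree condition for Hamilton-connectedness, for the subgraph on `xs`: degree sums exceed
  -- the order.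
  Dense : List A → Set
  Dense xs = ∀ u v → length xs < count (e u) xs + count (e v) xs

  Dense-resp-↭ : ∀ {xs ys} → xs ↭ ys → Dense xs → Dense ys
  Dense-resp-↭ eq dense u v
    rewrite sym (↭-length eq) | sym (count-↭ (e u) eq) | sym (count-↭ (e v) eq) = dense u v

  -- ls and rs are the two pieces of a linear order of the vertices cut between
  -- u and v.  If u v is not an edge, reversing a segment of rs up to a neighbour
  -- of u, or of ls up to a neighbour of v, makes the ends at the cut adjacent.
  -- Only rs has to be a path of the graph.
  swap-ends : ∀ {u v x y ls rs} → Dense (ls ++ rs) → Path Anything u x ls → Path E v y rs →
              ∃[ u′ ] ∃[ v′ ] ∃[ ls′ ] ∃[ rs′ ]
                Path Anything u′ x ls′ × Path E v′ y rs′ × E u′ v′ ×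
                length ls′ ≡ length ls × ls′ ++ rs′ ↭ ls ++ rs
  swap-ends {u} {v} {ls = ls} {rs} dense left right with e u v in uv
  ... | true = u , v , ls , rs , left , right , uv , refl , ↭-refl
  ... | false with crossing (e u) (e v) right
  ... | inj₁ (a , b , ys , zs , refl , l , m , ua , vb) =
        u , a , ls , ys ʳ++ zs , left , path-ʳ++ e-sym l vb m , ua , refl ,
        ++⁺ˡ ls (↭-sym (++↭ʳ++ ys zs))
  ... | inj₂ bound-right with crossing (e v) (e u) left
  ... | inj₁ (a , b , ys , zs , refl , l , m , va , _) =
        a , v , ys ʳ++ zs , rs , path-ʳ++ _ l _ m , right , e-sym va ,
        ↭-length (↭-sym (++↭ʳ++ ys zs)) , ++⁺ʳ rs (↭-sym (++↭ʳ++ ys zs))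
  -- If neither side can be rotated, the two bounds add up to a degree sum of at most
  -- `length (ls ++ rs)`, because neither `u` nor `v` is its own neighbour.
  ... | inj₂ bound-left = contradiction (dense u v) (ℕ.≤⇒≯ (begin
      count (e u) (ls ++ rs) + count (e v) (ls ++ rs)
        ≡⟨ cong₂ _+_ (count-++ (e u) ls rs) (count-++ (e v) ls rs) ⟩
      (count (e u) ls + count (e u) rs) + (count (e v) ls + count (e v) rs)
        ≡⟨ solve 4 (λ a b c d → (a :+ b) :+ (c :+ d) := (c :+ a) :+ (b :+ d)) refl
             (count (e u) ls) (count (e u) rs) (count (e v) ls) (count (e v) rs) ⟩
      (count (e v) ls + count (e u) ls) + (count (e u) rs + count (e v) rs)
        ≤⟨ ℕ.+-mono-≤ bound-left bound-right ⟩
      (length ls + ind (e u u)) + (length rs + ind (e v v))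
        ≡⟨ cong₂ (λ a b → (length ls + ind a) + (length rs + ind b)) (e-irrefl u) (e-irrefl v) ⟩
      (length ls + 0) + (length rs + 0)
        ≡⟨ cong₂ _+_ (ℕ.+-identityʳ (length ls)) (ℕ.+-identityʳ (length rs)) ⟩
      length ls + length rs
        ≡⟨ length-++ ls ⟨
      length (ls ++ rs) ∎))
    where
    open ℕ.≤-Reasoning
    open +-*-Solver

  -- Each round moves the left end across the cut over the edge found by `swap-ends`, until `x`
  -- itself has crossed. The induction runs on a bound `m` for the length because `swap-ends` may
  -- rearrange `ls`.
  join : ∀ m {u v x y ls rs} → length ls ≤ m → Dense (ls ++ rs) →
         Path Anything u x ls → Path E v y rs → ∃[ xs ] Path E x y xs × xs ↭ ls ++ rs
  join zero    {ls = _ ∷ _} ()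
  join (suc m) {ls = ls} {rs} ≤m dense left right with swap-ends dense left right
  ... | u , v , _ , rs′ , stop , right′ , uv , _ , eq = u ∷ rs′ , step uv right′ , eq
  ... | u , v , _ ∷ ls′ , rs′ , step _ left′ , right′ , uv , same-length , eq
    with join m (s≤s⁻¹ (subst (_≤ suc m) (sym same-length) ≤m)) (Dense-resp-↭ (↭-sym eq′) dense)
              left′ (step uv right′)
    where
    eq′ : ls′ ++ u ∷ rs′ ↭ ls ++ rs
    eq′ = ↭-trans (shift u ls′ rs′) eq
  ... | xs , path , eq″ = xs , path , ↭-trans eq″ (↭-trans (shift u ls′ rs′) eq)

  anything-to : ∀ x ys → ∃[ u ] Path Anything u x (ys ++ x ∷ [])
  anything-to x []       = x , stop
  anything-to x (y ∷ ys) = y , step _ (proj₂ (anything-to x ys))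

  -- Ore's criterion. `join` starts with `y` alone on the right and all other vertices on the left,
  -- in arbitrary order but with `x` farthest from the cut.
  hamiltonian-path : ∀ x y zs → Dense (x ∷ y ∷ zs) →
                     ∃[ xs ] Path E x y xs × xs ↭ x ∷ y ∷ zs
  hamiltonian-path x y zs dense =
    let xs , path , eq′ = join (length (zs ++ x ∷ [])) ℕ.≤-refl (Dense-resp-↭ (↭-sym eq) dense)
                               (proj₂ (anything-to x zs)) stop
    in xs , path , ↭-trans eq′ eq
    where
    eq : (zs ++ x ∷ []) ++ y ∷ [] ↭ x ∷ y ∷ zs
    eq = ↭-trans (↭-reflexive (++-assoc zs (x ∷ []) (y ∷ []))) (++-comm zs (x ∷ y ∷ []))

-- Weights of walks modulo 2.

weight : (A → A → Bool) → List A → Bool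
weight h []           = false
weight h (x ∷ [])     = false
weight h (x ∷ y ∷ xs) = h x y xor weight h (y ∷ xs)

weight-step : ∀ {R : A → A → Set} (h : A → A → Bool) x {u v xs} → Path R u v xs →
              weight h (x ∷ xs) ≡ h x u xor weight h xs
weight-step h x stop       = refl
weight-step h x (step _ _) = refl

weight-++ : ∀ {R : A → A → Set} (h : A → A → Bool) {u v w z xs ys} →
            Path R u v xs → Path R w z ys →
            weight h (xs ++ ys) ≡ weight h xs xor (h v w xor weight h ys)
weight-++ h stop q = weight-step h _ q
weight-++ h {v = v} {w} {xs = x ∷ xs} {ys} (step {y = y} r p) q = begin
  weight h (x ∷ xs ++ ys)                               ≡⟨ first p ⟩
  h x y xor weight h (xs ++ ys)                         ≡⟨ cong (h x y xor_) (weight-++ h p q) ⟩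
  h x y xor (weight h xs xor (h v w xor weight h ys))   ≡⟨ Bool.xor-assoc (h x y) _ _ ⟨
  (h x y xor weight h xs) xor (h v w xor weight h ys)   ≡⟨ cong (_xor _) (weight-step h x p) ⟨
  weight h (x ∷ xs) xor (h v w xor weight h ys)         ∎
  where
  open ≡-Reasoning
  first : ∀ {z xs} → Path _ y z xs → weight h (x ∷ xs ++ ys) ≡ h x y xor weight h (xs ++ ys)
  first stop       = refl
  first (step _ _) = refl

-- Turns the order in which `hexagon` establishes distinctness into the one that `spanning-path`
-- expects: the ends `v`, `z`, then the six vertices to be left out.
interleave-↭ : ∀ {A : Set} (t s z y w x u v : A) →
          t ∷ s ∷ z ∷ y ∷ w ∷ x ∷ u ∷ v ∷ [] ↭ v ∷ z ∷ w ∷ t ∷ x ∷ u ∷ s ∷ y ∷ []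
interleave-↭ t s z y w x u v =
  ↭-trans (++-comm (t ∷ s ∷ z ∷ y ∷ w ∷ x ∷ u ∷ []) (v ∷ []))
  (↭-prep v (↭-trans (shift z (t ∷ s ∷ []) _) (↭-prep z
  (↭-trans (shift w (t ∷ s ∷ y ∷ []) _) (↭-prep w (↭-prep t
  (↭-trans (++-comm (s ∷ y ∷ []) (x ∷ u ∷ [])) ↭-refl)))))))

-- Even hexagons and even closed walks.

module EvenCycle {n} (G : Graph n)
  (degrees : ∀ u v → n + 8 ≤ count (adj G u) (allFin n) + count (adj G v) (allFin n)) where

  open Hamiltonian (adj G) (symm G) (irrefl G)

  E⇒≢ : ∀ {u v} → E u v → u ≢ v
  E⇒≢ {u} uv refl with trans (sym uv) (irrefl G u)
  ... | ()

  abstract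
    -- Leaving out `zs` lowers a degree sum by at most twice `length zs` and the order by
    -- `length zs`. The surplus of 8 over the order thus stays at least 2, and Ore's condition asks
    -- for 1.
    spanning-path : ∀ x y zs → length zs ≤ 6 → Unique (x ∷ y ∷ zs) →
                    ∃[ xs ] Path E x y xs × xs ++ zs ↭ allFin n
    spanning-path x y zs ≤6 uniq with unique-⊆⇒↭ uniq (λ _ → ∈-allFin _)
    ... | ws , eq =
      let xs , path , eq″ = hamiltonian-path x y ws dense
      in xs , path , ↭-trans (++⁺ʳ zs eq″) (↭-trans (++-comm (x ∷ y ∷ ws) zs) eq′)
      where
      eq′ : zs ++ x ∷ y ∷ ws ↭ allFin n
      eq′ = ↭-trans (shifts zs (x ∷ y ∷ [])) eq

      total : length zs + length (x ∷ y ∷ ws) ≡ n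
      total = trans (sym (length-++ zs)) (trans (↭-length eq′) (length-tabulate {n = n} (λ i → i)))

      dense : Dense (x ∷ y ∷ ws)
      dense u v = ℕ.+-cancelˡ-≤ (length zs + 6) _ _ (begin
        length zs + 6 + suc (length (x ∷ y ∷ ws))
          ≡⟨ solve 2 (λ a b → a :+ con 6 :+ (con 1 :+ b) := a :+ b :+ con 7) refl
               (length zs) (length (x ∷ y ∷ ws)) ⟩
        length zs + length (x ∷ y ∷ ws) + 7
          ≡⟨ cong (_+ 7) total ⟩
        n + 7
          ≤⟨ ℕ.+-monoʳ-≤ n (ℕ.n≤1+n 7) ⟩
        n + 8
          ≤⟨ degrees u v ⟩
        count (adj G u) (allFin n) + count (adj G v) (allFin n)
          ≤⟨ ℕ.+-mono-≤ (part u) (part v) ⟩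
        (length zs + count (adj G u) (x ∷ y ∷ ws)) + (length zs + count (adj G v) (x ∷ y ∷ ws))
          ≤⟨ ℕ.+-monoʳ-≤ _ (ℕ.+-monoˡ-≤ _ ≤6) ⟩
        (length zs + count (adj G u) (x ∷ y ∷ ws)) + (6 + count (adj G v) (x ∷ y ∷ ws))
          ≡⟨ solve 3 (λ a b c → (a :+ b) :+ (con 6 :+ c) := (a :+ con 6) :+ (b :+ c)) refl
               (length zs) (count (adj G u) (x ∷ y ∷ ws)) (count (adj G v) (x ∷ y ∷ ws)) ⟩
        length zs + 6 + (count (adj G u) (x ∷ y ∷ ws) + count (adj G v) (x ∷ y ∷ ws)) ∎)
        where
        open ℕ.≤-Reasoning
        open +-*-Solver
        part : ∀ u → count (adj G u) (allFin n) ≤ length zs + count (adj G u) (x ∷ y ∷ ws)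
        part u = begin
          count (adj G u) (allFin n)                               ≡⟨ count-↭ (adj G u) eq′ ⟨
          count (adj G u) (zs ++ x ∷ y ∷ ws)                       ≡⟨ count-++ (adj G u) zs _ ⟩
          count (adj G u) zs + count (adj G u) (x ∷ y ∷ ws)        ≤⟨ ℕ.+-monoˡ-≤ _ (count≤length (adj G u) zs) ⟩
          length zs + count (adj G u) (x ∷ y ∷ ws)                 ∎

    -- By inclusion-exclusion `u` and `v`, equal or not, have at least 8 common neighbours, so 7
    -- forbidden vertices cannot exhaust them.
    common-neighbour : ∀ u v zs → length zs ≤ 7 → ∃[ x ] E u x × E x v × All (x ≢_) zs
    common-neighbour u v zs ≤7
      with Fin.any? (λ x → ((adj G u x ∧ adj G v x) Bool.≟ true) ×-dec All.all? (λ z → ¬? (x Fin.≟ z)) zs)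
    ... | yes (x , uvx , x∉) = x , Bool.∧-conicalˡ _ _ uvx , symm G (Bool.∧-conicalʳ _ _ uvx) , x∉
    ... | no none = contradiction (degrees u v) (ℕ.<⇒≱ (begin-strict
        count (adj G u) (allFin n) + count (adj G v) (allFin n)
          ≤⟨ count-∧ (adj G u) (adj G v) (allFin n) ⟩
        length (allFin n) + count both (allFin n)
          ≡⟨ cong (_+ count both (allFin n)) (length-tabulate {n = n} (λ i → i)) ⟩
        n + count both (allFin n)
          ≤⟨ ℕ.+-monoʳ-≤ n (ℕ.m≤m+n _ _) ⟩
        n + (count both (allFin n) + length (proj₁ rest))
          ≡⟨ cong (n +_) (trans (sym (length-++ (filter both? (allFin n)))) (↭-length (proj₂ rest))) ⟩
        n + length zs
          ≤⟨ ℕ.+-monoʳ-≤ n ≤7 ⟩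
        n + 7
          <⟨ ℕ.+-monoʳ-< n ℕ.≤-refl ⟩
        n + 8 ∎))
      where
      open ℕ.≤-Reasoning
      open DecMembership (Fin._≟_ {n}) using (_∈?_)

      both : Fin n → Bool
      both x = adj G u x ∧ adj G v x

      both? : ∀ x → Dec (both x ≡ true)
      both? x = both x Bool.≟ true

      listed : filter both? (allFin n) ⊆ zs
      listed {x} x∈ with x ∈? zs
      ... | yes x∈zs = x∈zs
      ... | no x∉zs = contradiction
        (x , proj₂ (∈-filter⁻ both? {xs = allFin n} x∈) , ¬Any⇒All¬ zs x∉zs) none

      rest : ∃[ ws ] filter both? (allFin n) ++ ws ↭ zs
      rest = unique-⊆⇒↭ (Unique.filter⁺ both? (Unique.allFin⁺ n)) listed

  -- The assumption to be refuted: every Hamilton cycle, given as a spanning path and its closing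
  -- edge `z v`, has odd weight.
  module Odd (h : Fin n → Fin n → Bool) (h-sym : ∀ u v → h u v ≡ h v u)
    (odd : ∀ {v z xs} → Path E v z xs → E z v → xs ↭ allFin n → weight h xs xor h z v ≡ true)
    where

    hexagon : ∀ {u x v y w z} → Unique (z ∷ y ∷ w ∷ x ∷ u ∷ v ∷ []) →
              E u x → E x v → E v y → E y w → E w z → E z u →
              (h u x xor h x v) xor ((h v y xor h y w) xor (h w z xor h z u)) ≡ false
    hexagon {u} {x} {v} {y} {w} {z} uniq ux xv vy yw wz zu =
      let s , us , sy , s∉ = common-neighbour u y (z ∷ y ∷ w ∷ x ∷ u ∷ v ∷ []) (ℕ.n≤1+n 6)
          -- `t` must avoid the six corners and `s`, exactly the seven vertices that
          -- `common-neighbour` allows.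
          t , wt , tx , t∉ = common-neighbour w x (s ∷ z ∷ y ∷ w ∷ x ∷ u ∷ v ∷ []) ℕ.≤-refl
          xs , path , eq = spanning-path v z (w ∷ t ∷ x ∷ u ∷ s ∷ y ∷ []) ℕ.≤-refl
                             (Unique-resp-↭ (interleave-↭ t s z y w x u v) (t∉ ∷ s∉ ∷ uniq))
      in switch us sy wt tx path eq
      where
      switch : ∀ {s t xs} → E u s → E s y → E w t → E t x → Path E v z xs →
               xs ++ w ∷ t ∷ x ∷ u ∷ s ∷ y ∷ [] ↭ allFin n →
               (h u x xor h x v) xor ((h v y xor h y w) xor (h w z xor h z u)) ≡ false
      switch {s} {t} {xs} us sy wt tx path eq = begin
        (h u x xor h x v) xor ((h v y xor h y w) xor (h w z xor h z u))
          -- The three joining paths occur in both cycles and cancel; every edge of the hexagon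
          -- occurs in just one of them.
          ≡⟨ solve 11 (λ p ux xv vy yw wz zu wt tx us sy →
               (ux :+ xv) :+ ((vy :+ yw) :+ (wz :+ zu)) :=
               ((p :+ (wz :+ (wt :+ (tx :+ (ux :+ (us :+ (sy :+ con false))))))) :+ vy) :+
               ((p :+ (zu :+ (us :+ (sy :+ (yw :+ (wt :+ (tx :+ con false))))))) :+ xv)) refl
             (weight h xs) (h u x) (h x v) (h v y) (h y w) (h w z) (h z u)
             (h w t) (h t x) (h u s) (h s y) ⟩
        ((weight h xs xor (h w z xor
           (h w t xor (h t x xor (h u x xor (h u s xor (h s y xor false))))))) xor h v y) xor
        ((weight h xs xor (h z u xor
           (h u s xor (h s y xor (h y w xor (h w t xor (h t x xor false))))))) xor h x v)
          ≡⟨ cong₂ _xor_ cycle₁ cycle₂ ⟩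
        false ∎
        where
        open ≡-Reasoning
        open xor-∧-Solver

        -- v … z w t x u s y v, with the matching {u x, v y, w z}
        cycle₁ : (weight h xs xor (h w z xor
                   (h w t xor (h t x xor (h u x xor (h u s xor (h s y xor false))))))) xor h v y ≡ true
        cycle₁ rewrite h-sym w z | h-sym u x | h-sym v y =
          trans (cong (_xor h y v) (sym (weight-++ h path path₁)))
                (odd (path-++ path (symm G wz) path₁) (symm G vy) eq)
          where
          path₁ : Path E w y (w ∷ t ∷ x ∷ u ∷ s ∷ y ∷ [])
          path₁ = step wt (step tx (step (symm G ux) (step us (step sy stop))))

        -- v … z u s y w t x v, with the matching {x v, y w, z u}
        cycle₂ : (weight h xs xor (h z u xor
                   (h u s xor (h s y xor (h y w xor (h w t xor (h t x xor false))))))) xor h x v ≡ true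
        cycle₂ =
          trans (cong (_xor h x v) (sym (weight-++ h path path₂)))
                (odd (path-++ path zu path₂) xv
                     (↭-trans (++⁺ˡ xs (++-comm (u ∷ s ∷ y ∷ []) (w ∷ t ∷ x ∷ []))) eq))
          where
          path₂ : Path E u x (u ∷ s ∷ y ∷ w ∷ t ∷ x ∷ [])
          path₂ = step us (step sy (step yw (step wt (step tx stop))))

    via-hexagons : ∀ {u v x x′} → u ≢ v → x ≢ x′ → E u x → E x v → E u x′ → E x′ v →
                   h u x xor h x v ≡ h u x′ xor h x′ v
    via-hexagons {u} {v} {x} {x′} u≢v x≢x′ ux xv ux′ x′v
      -- Only a fresh vertex `w` is wanted here, and a neighbour of `u` provides one.
      with common-neighbour u u (x′ ∷ x ∷ u ∷ v ∷ []) (ℕ.m≤m+n 4 3)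
    ... | w , _ , _ , wx′ ∷ wx ∷ wu ∷ wv ∷ []
      with common-neighbour v w (w ∷ x′ ∷ x ∷ u ∷ v ∷ []) (ℕ.m≤m+n 5 2)
    ... | y , vy , yw , yw′ ∷ yx′ ∷ yx ∷ yu ∷ yv ∷ []
      with common-neighbour w u (y ∷ w ∷ x′ ∷ x ∷ u ∷ v ∷ []) (ℕ.m≤m+n 6 1)
    ... | z , wz , zu , zy ∷ zw ∷ zx′ ∷ zx ∷ zu′ ∷ zv ∷ [] =
      xor-cancel
        (hexagon ((zy ∷ zw ∷ zx ∷ zu′ ∷ zv ∷ []) ∷ (yw′ ∷ yx ∷ yu ∷ yv ∷ []) ∷ (wx ∷ wu ∷ wv ∷ []) ∷
                  (E⇒≢ (symm G ux) ∷ E⇒≢ xv ∷ []) ∷ (u≢v ∷ []) ∷ [] ∷ []) ux xv vy yw wz zu)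
        (hexagon ((zy ∷ zw ∷ zx′ ∷ zu′ ∷ zv ∷ []) ∷ (yw′ ∷ yx′ ∷ yu ∷ yv ∷ []) ∷ (wx′ ∷ wu ∷ wv ∷ []) ∷
                  (E⇒≢ (symm G ux′) ∷ E⇒≢ x′v ∷ []) ∷ (u≢v ∷ []) ∷ [] ∷ []) ux′ x′v vy yw wz zu)
      where
      xor-cancel : ∀ {a b c} → a xor c ≡ false → b xor c ≡ false → a ≡ b
      xor-cancel {false} {false} _ _ = refl
      xor-cancel {true}  {true}  _ _ = refl
      xor-cancel {true}  {false} {false} () _
      xor-cancel {true}  {false} {true}  _ ()
      xor-cancel {false} {true}  {false} _ ()
      xor-cancel {false} {true}  {true}  () _

    via-unique : ∀ {u v x x′} → E u x → E x v → E u x′ → E x′ v →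
                 h u x xor h x v ≡ h u x′ xor h x′ v
    via-unique {u} {v} {x} {x′} ux xv ux′ x′v with u Fin.≟ v | x Fin.≟ x′
    ... | no u≢v | no x≢x′ = via-hexagons u≢v x≢x′ ux xv ux′ x′v
    ... | _ | yes refl = refl
    ... | yes refl | no _ = trans (back x) (sym (back x′))
      where
      back : ∀ x → h u x xor h x u ≡ false
      back x rewrite h-sym x u = Bool.xor-same (h u x)

    -- The common weight of all paths u x v; it is a coboundary by via-trans.
    via : Fin n → Fin n → Bool
    via u v = let x , _ = common-neighbour u v [] z≤n in h u x xor h x v

    via-≡ : ∀ {u x v} → E u x → E x v → h u x xor h x v ≡ via u v
    via-≡ {u} {v = v} ux xv =
      let _ , ux′ , x′v , _ = common-neighbour u v [] z≤n in via-unique ux xv ux′ x′v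

    via-self : ∀ u → via u u ≡ false
    via-self u =
      let x , _ = common-neighbour u u [] z≤n
      in trans (cong (h u x xor_) (h-sym x u)) (Bool.xor-same (h u x))

    via-sym : ∀ u v → via u v ≡ via v u
    via-sym u v =
      let x , ux , xv , _ = common-neighbour u v [] z≤n
      in trans (trans (Bool.xor-comm (h u x) (h x v)) (cong₂ _xor_ (h-sym x v) (h-sym u x)))
               (via-≡ (symm G xv) (symm G ux))

    -- The three vertices become alternate corners of a hexagon whose other corners are common
    -- neighbours chosen to be distinct.
    via-triangle-≢ : ∀ {u v w} → u ≢ v → v ≢ w → w ≢ u → via u v xor (via v w xor via w u) ≡ false
    via-triangle-≢ {u} {v} {w} u≢v v≢w w≢u
      with common-neighbour u v (w ∷ u ∷ v ∷ []) (ℕ.m≤m+n 3 4)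
    ... | x , ux , xv , xw ∷ xu ∷ xv′ ∷ []
      with common-neighbour v w (w ∷ x ∷ u ∷ v ∷ []) (ℕ.m≤m+n 4 3)
    ... | y , vy , yw , y∉
      with common-neighbour w u (y ∷ w ∷ x ∷ u ∷ v ∷ []) (ℕ.m≤m+n 5 2)
    ... | z , wz , zu , z∉ =
      trans (sym (cong₂ _xor_ (via-≡ ux xv) (cong₂ _xor_ (via-≡ vy yw) (via-≡ wz zu))))
            (hexagon (z∉ ∷ y∉ ∷ ((xw ∘ sym) ∷ w≢u ∷ (v≢w ∘ sym) ∷ []) ∷ (xu ∷ xv′ ∷ []) ∷
                      (u≢v ∷ []) ∷ [] ∷ []) ux xv vy yw wz zu)

    via-triangle : ∀ u v w → via u v xor (via v w xor via w u) ≡ false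
    via-triangle u v w with u Fin.≟ v | v Fin.≟ w | w Fin.≟ u
    ... | no u≢v | no v≢w | no w≢u = via-triangle-≢ u≢v v≢w w≢u
    ... | yes refl | _ | _ rewrite via-self u | via-sym u w = Bool.xor-same (via w u)
    ... | no _ | yes refl | _ rewrite via-self v | via-sym u v = Bool.xor-same (via v u)
    ... | no _ | no _ | yes refl rewrite via-self u | via-sym u v | Bool.xor-identityʳ (via v u) =
      Bool.xor-same (via v u)

    via-trans : ∀ u v w → via u v xor via v w ≡ via u w
    via-trans u v w = begin
      via u v xor via v w
        ≡⟨ solve 3 (λ a b c → a :+ b := (a :+ (b :+ c)) :+ c) refl (via u v) (via v w) (via w u) ⟩
      (via u v xor (via v w xor via w u)) xor via w u
        ≡⟨ cong (_xor via w u) (via-triangle u v w) ⟩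
      via w u
        ≡⟨ via-sym w u ⟩
      via u w ∎
      where
      open ≡-Reasoning
      open xor-∧-Solver

    -- `suc (k * 2)` vertices mean `k * 2` edges. Taken two at a time, these contribute values of
    -- `via`, which telescope by `via-trans`.
    weight-even : ∀ k {u v xs} → Path E u v xs → length xs ≡ suc (k * 2) → weight h xs ≡ via u v
    weight-even zero    stop               refl = sym (via-self _)
    weight-even zero    (step _ stop)      ()
    weight-even zero    (step _ (step _ _)) ()
    weight-even (suc k) stop               ()
    weight-even (suc k) (step _ stop)      ()
    weight-even (suc k) {u} {v} (step {y = x} {xs = xs} ux (step {y = w} {xs = ys} xw p)) len = begin
      h u x xor weight h xs
        ≡⟨ cong (h u x xor_) (weight-step h x p) ⟩
      h u x xor (h x w xor weight h ys)
        ≡⟨ Bool.xor-assoc (h u x) (h x w) (weight h ys) ⟨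
      (h u x xor h x w) xor weight h ys
        ≡⟨ cong₂ _xor_ (via-≡ ux xw)
             (weight-even k p (ℕ.suc-injective (ℕ.suc-injective len))) ⟩
      via u w xor via w v
        ≡⟨ via-trans u w v ⟩
      via u v ∎
      where
      open ≡-Reasoning

    -- A spanning path from `v` to a neighbour `z` closes to a Hamilton cycle. It is odd by
    -- assumption, but as a closed walk with `n` edges it is even by `weight-even`.
    impossible : ∀ k → n ≡ k * 2 → Fin n → ⊥
    impossible k n≡2k v
      with common-neighbour v v [] z≤n
    ... | z , vz , zv , _
      with spanning-path v z [] z≤n ((E⇒≢ vz ∷ []) ∷ [] ∷ [])
    ... | xs , path , eq rewrite ++-identityʳ xs
      with trans (sym (odd path zv eq)) (begin
        weight h xs xor h z v
          ≡⟨ cong (weight h xs xor_) (Bool.xor-identityʳ (h z v)) ⟨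
        weight h xs xor (h z v xor false)
          ≡⟨ weight-++ h path (stop {R = E} {x = v}) ⟨
        weight h (xs ++ v ∷ [])
          ≡⟨ weight-even k (path-++ path zv stop) (trans (length-++ xs) (trans (ℕ.+-comm _ 1)
               (cong suc (trans (↭-length eq) (trans (length-tabulate {n = n} (λ i → i)) n≡2k))))) ⟩
        via v v
          ≡⟨ via-self v ⟩
        false ∎)
      where open ≡-Reasoning
    ... | ()

-- Parity of colour counts on a cycle.

isOdd : ℕ → Bool
isOdd zero    = false
isOdd (suc n) = not (isOdd n)

%2≡1⇒isOdd : ∀ n → n % 2 ≡ 1 → isOdd n ≡ true
%2≡1⇒isOdd (suc zero)    _  = refl
%2≡1⇒isOdd (suc (suc n)) eq = trans (Bool.not-involutive (isOdd n)) (%2≡1⇒isOdd n eq)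

isOdd-*2 : ∀ k → isOdd (k * 2) ≡ false
isOdd-*2 zero    = refl
isOdd-*2 (suc k) = trans (Bool.not-involutive (isOdd (k * 2))) (isOdd-*2 k)

isOdd-filter-∷ : ∀ {P : A → Set} (P? : Decidable P) x xs →
                 isOdd (length (filter P? (x ∷ xs))) ≡
                 does (P? x) xor isOdd (length (filter P? xs))
isOdd-filter-∷ P? x xs with does (P? x)
... | false = refl
... | true  = refl

-- Meant for `f` listing the `m` pairs of consecutive indices among `suc m`; the closing edge is
-- treated separately.
isOdd-filter-tabulate : ∀ (h : A → A → Bool) {B : Set} {P : B → Set} (P? : Decidable P)
  m (φ : Fin (suc m) → A) (f : Fin m → B) →
  (∀ k → does (P? (f k)) ≡ h (φ (inject₁ k)) (φ (Fin.suc k))) →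
  isOdd (length (filter P? (tabulate f))) ≡ weight h (tabulate φ)
isOdd-filter-tabulate h P? zero    φ f eq = refl
isOdd-filter-tabulate h P? (suc m) φ f eq =
  trans (isOdd-filter-∷ P? (f Fin.zero) _)
        (cong₂ _xor_ (eq Fin.zero)
          (isOdd-filter-tabulate h P? m (φ ∘ Fin.suc) (f ∘ Fin.suc) (eq ∘ Fin.suc)))

-- Each of the `length xs` steps flips once.
weight-not : ∀ (h h′ : A → A → Bool) → (∀ a b → h′ a b ≡ not (h a b)) → ∀ x xs →
             weight h′ (x ∷ xs) ≡ isOdd (length xs) xor weight h (x ∷ xs)
weight-not h h′ eq x []       = refl
weight-not h h′ eq x (y ∷ xs) = begin
  h′ x y xor weight h′ (y ∷ xs)
    ≡⟨ cong₂ _xor_ (eq x y) (weight-not h h′ eq y xs) ⟩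
  not (h x y) xor (isOdd (length xs) xor weight h (y ∷ xs))
    ≡⟨ Bool.not-distribˡ-xor (h x y) _ ⟨
  not (h x y xor (isOdd (length xs) xor weight h (y ∷ xs)))
    ≡⟨ solve 3 (λ a b c → con true :+ (a :+ (b :+ c)) := (con true :+ b) :+ (a :+ c)) refl
         (h x y) (isOdd (length xs)) (weight h (y ∷ xs)) ⟩
  not (isOdd (length xs)) xor (h x y xor weight h (y ∷ xs)) ∎
  where
  open ≡-Reasoning
  open xor-∧-Solver

does⇒ : ∀ {P : Set} (P? : Dec P) → does P? ≡ true → P
does⇒ (yes p) _ = p

-- The closing edge is written `(0 , m)` because `edges` puts the smaller end first.
cycleEdges : ∀ m → List (Fin (suc m) × Fin (suc m))
cycleEdges m = (Fin.zero , fromℕ m) ∷ tabulate (λ i → inject₁ i , Fin.suc i)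

Next⇒ : ∀ {m} {u v : Fin (suc m)} → Next u v →
        (∃[ k ] u ≡ inject₁ k × v ≡ Fin.suc k) ⊎ (u ≡ fromℕ m × v ≡ Fin.zero)
Next⇒ {v = Fin.suc k} (inj₁ eq) =
  inj₁ (k , Fin.toℕ-injective (trans (sym (ℕ.suc-injective eq)) (sym (Fin.toℕ-inject₁ k))) , refl)
Next⇒ {v = Fin.zero} (inj₂ (eq , _)) =
  inj₂ (Fin.toℕ-injective (trans (ℕ.suc-injective eq) (sym (Fin.toℕ-fromℕ _))) , refl)

-- Both lists are free of repetitions, so equal membership suffices. `2 ≤ m` keeps the closing edge
-- apart from `(0 , 1)`.
edges-C : ∀ m → 2 ≤ m → edges (C (suc m)) ↭ cycleEdges m
edges-C m 2≤m = ∼bag⇒↭ (unique∧set⇒bag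
  (Unique.filter⁺ (edge? (C (suc m)))
    (Unique.cartesianProduct⁺ (Unique.allFin⁺ (suc m)) (Unique.allFin⁺ (suc m))))
  (tabulate⁺ distinct ∷ Unique.tabulate⁺ (Fin.suc-injective ∘ cong proj₂))
  (mk⇔ to from))
  where
  distinct : ∀ i → (Fin.zero , fromℕ m) ≢ (inject₁ i , Fin.suc i)
  distinct Fin.zero eq = ℕ.<⇒≢ 2≤m
    (sym (trans (sym (Fin.toℕ-fromℕ m)) (cong (toℕ ∘ proj₂) eq)))

  to : ∀ {e} → e ∈ edges (C (suc m)) → e ∈ cycleEdges m
  to {u , v} e∈
    with ∈-filter⁻ (edge? (C (suc m))) {xs = cartesianProduct (allFin _) (allFin _)} e∈
  ... | _ , u<v , uv with does⇒ (cycleAdj? u v) uv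
  ... | _ , inj₁ next with Next⇒ next
  ... | inj₁ (k , refl , refl) = there (∈-tabulate⁺ k)
  ... | inj₂ (_ , refl) = contradiction u<v λ ()
  to {u , v} e∈ | _ , u<v , uv | _ , inj₂ next with Next⇒ next
  ... | inj₁ (k , refl , refl) = contradiction u<v
    (ℕ.<-asym (s≤s (ℕ.≤-reflexive (Fin.toℕ-inject₁ k))))
  ... | inj₂ (refl , refl) = here refl

  edge∈ : ∀ {u v} → u Fin.< v → CycleAdj u v → (u , v) ∈ edges (C (suc m))
  edge∈ {u} {v} u<v adj = ∈-filter⁺ (edge? (C (suc m)))
    (∈-cartesianProduct⁺ (∈-allFin u) (∈-allFin v)) (u<v , dec-true (cycleAdj? u v) adj)

  from : ∀ {e} → e ∈ cycleEdges m → e ∈ edges (C (suc m))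
  from (here refl) = edge∈ 0<m (Fin.<⇒≢ 0<m , inj₂ (inj₂ (cong suc (Fin.toℕ-fromℕ m) , refl)))
    where
    0<m : Fin.zero {m} Fin.< fromℕ m
    0<m = subst (0 <_) (sym (Fin.toℕ-fromℕ m)) (ℕ.<-trans (s≤s z≤n) 2≤m)
  from (there e∈) with ∈-tabulate⁻ e∈
  ... | k , refl = edge∈ k<1+k (Fin.<⇒≢ k<1+k , inj₁ (inj₁ (cong suc (sym (Fin.toℕ-inject₁ k)))))
    where
    k<1+k : inject₁ k Fin.< Fin.suc k
    k<1+k = s≤s (ℕ.≤-reflexive (Fin.toℕ-inject₁ k))

isOdd-colourCount : ∀ m → 2 ≤ m → ∀ {n r} (φ : Fin (suc m) → Fin n) (c : Fin n → Fin n → Fin r) i →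
  let h = λ a b → does (c a b Fin.≟ i) in
  isOdd (colourCount (C (suc m)) φ c i) ≡
  h (φ Fin.zero) (φ (fromℕ m)) xor weight h (tabulate φ)
isOdd-colourCount m 2≤m φ c i = begin
  isOdd (length (filter P? (edges (C (suc m)))))
    ≡⟨ cong isOdd (↭-length (filter-↭ P? (edges-C m 2≤m))) ⟩
  isOdd (length (filter P? (cycleEdges m)))
    ≡⟨ isOdd-filter-∷ P? (Fin.zero , fromℕ m) _ ⟩
  h (φ Fin.zero) (φ (fromℕ m)) xor isOdd (length (filter P? (tabulate λ k → inject₁ k , Fin.suc k)))
    ≡⟨ cong (h (φ Fin.zero) (φ (fromℕ m)) xor_)
         (isOdd-filter-tabulate h P? m φ (λ k → inject₁ k , Fin.suc k) (λ _ → refl)) ⟩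
  h (φ Fin.zero) (φ (fromℕ m)) xor weight h (tabulate φ) ∎
  where
  open ≡-Reasoning
  h = λ a b → does (c a b Fin.≟ i)
  P? = λ ((a , b) : Fin (suc m) × Fin (suc m)) → c (φ a) (φ b) Fin.≟ i

-- Hamilton cycles as copies of `C n`.

path-tabulate : ∀ {R : A → A → Set} m (φ : Fin (suc m) → A) {v z} → Path R v z (tabulate φ) →
  v ≡ φ Fin.zero × z ≡ φ (fromℕ m) × (∀ k → R (φ (inject₁ k)) (φ (Fin.suc k)))
path-tabulate zero    φ stop        = refl , refl , λ ()
path-tabulate zero    φ (step _ ())
path-tabulate {R = R} (suc m) φ (step r p) with path-tabulate m (φ ∘ Fin.suc) p
... | refl , refl , rs = refl , refl , λ where
  Fin.zero    → r
  (Fin.suc k) → rs k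

unique-tabulate⁻ : ∀ {n} (φ : Fin n → A) → Unique (tabulate φ) → ∀ {i j} → φ i ≡ φ j → i ≡ j
unique-tabulate⁻ φ _          {Fin.zero}  {Fin.zero}  _  = refl
unique-tabulate⁻ φ (φ0∉ ∷ _)  {Fin.zero}  {Fin.suc j} eq = contradiction eq (tabulate⁻ φ0∉ j)
unique-tabulate⁻ φ (φ0∉ ∷ _)  {Fin.suc i} {Fin.zero}  eq = contradiction (sym eq) (tabulate⁻ φ0∉ i)
unique-tabulate⁻ φ (_ ∷ uniq) {Fin.suc i} {Fin.suc j} eq =
  cong Fin.suc (unique-tabulate⁻ (φ ∘ Fin.suc) uniq eq)

as-tabulate : ∀ {n} (xs : List A) → length xs ≡ n → ∃[ φ ] tabulate {n = n} φ ≡ xs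
as-tabulate xs refl = lookup xs , tabulate-lookup xs

cycle-isCopy : ∀ {m} (G : Graph (suc m)) (φ : Fin (suc m) → Fin (suc m)) {v z} →
  Path (λ a b → adj G a b ≡ true) v z (tabulate φ) → adj G z v ≡ true →
  tabulate φ ↭ allFin (suc m) → IsCopy (C (suc m)) G φ
cycle-isCopy {m} G φ path zv eq with path-tabulate m φ path
... | refl , refl , consecutive =
  unique-tabulate⁻ φ (Unique-resp-↭ (↭-sym eq) (Unique.allFin⁺ (suc m))) , hom
  where
  next : ∀ {a b} → Next a b → adj G (φ a) (φ b) ≡ true
  next ab with Next⇒ ab
  ... | inj₁ (k , refl , refl) = consecutive k
  ... | inj₂ (refl , refl)     = zv

  hom : ∀ {a b} → adj (C (suc m)) a b ≡ true → adj G (φ a) (φ b) ≡ true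
  hom {a} {b} ab with does⇒ (cycleAdj? a b) ab
  ... | _ , inj₁ ab′ = next ab′
  ... | _ , inj₂ ba′ = symm G (next ba′)

-- Colourings with at most two colours.

ZeroOrComplement : ∀ {r} → Fin (suc r) → Set
ZeroOrComplement i =
  i ≡ Fin.zero ⊎ (∀ j → does (j Fin.≟ i) ≡ not (does (j Fin.≟ Fin.zero)))

one-colour : (i : Fin 1) → ZeroOrComplement i
one-colour Fin.zero = inj₁ refl

two-colours : (i : Fin 2) → ZeroOrComplement i
two-colours Fin.zero           = inj₁ refl
two-colours (Fin.suc Fin.zero) = inj₂ λ { Fin.zero → refl ; (Fin.suc Fin.zero) → refl }

-- `ZeroOrComplement` treats one and two colours together: a colour class is that of colour 0 or its
-- complement, and on a cycle with evenly many edges both have the same parity. So colour 0 is odd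
-- on every Hamilton cycle, which `impossible` refutes.
no-odd-colouring : ∀ {n r} k → n ≡ k * 2 → 4 ≤ n → (G : Graph n) →
  (∀ u v → n + 8 ≤ count (adj G u) (allFin n) + count (adj G v) (allFin n)) →
  (∀ (i : Fin (suc r)) → ZeroOrComplement i) → ¬ HasOddColouring G (C n) (suc r)
no-odd-colouring {suc m} k n≡2k 4≤n G degrees split (_ , χ , oddCopies) =
  impossible k n≡2k Fin.zero
  where
  c = colour χ

  red : Fin (suc m) → Fin (suc m) → Bool
  red a b = does (c a b Fin.≟ Fin.zero)

  2≤m : 2 ≤ m
  2≤m = ℕ.≤-trans (ℕ.n≤1+n 2) (s≤s⁻¹ 4≤n)

  isOdd-m : isOdd m ≡ true
  isOdd-m = trans (sym (Bool.not-involutive (isOdd m)))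
                  (cong not (trans (cong isOdd n≡2k) (isOdd-*2 k)))

  red-parity : ∀ (φ : Fin (suc m) → Fin (suc m)) i → isOdd (colourCount (C (suc m)) φ c i) ≡ true →
               red (φ Fin.zero) (φ (fromℕ m)) xor weight red (tabulate φ) ≡ true
  red-parity φ i odd with split i
  ... | inj₁ refl = trans (sym (isOdd-colourCount m 2≤m φ c Fin.zero)) odd
  -- Complementing flips the closing edge and the `m` consecutive edges; as `m` is odd, the changes
  -- cancel.
  ... | inj₂ complement = begin
    a xor b                            ≡⟨ solve 2 (λ a b → a :+ b := (con true :+ a) :+ (con true :+ b)) refl a b ⟩
    not a xor (true xor b)             ≡⟨ cong₂ _xor_ (sym (complement (c (φ Fin.zero) (φ (fromℕ m)))))
                                            (cong (_xor b) (sym (trans (cong isOdd (length-tabulate (φ ∘ Fin.suc))) isOdd-m))) ⟩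
    h (φ Fin.zero) (φ (fromℕ m)) xor (isOdd (length (tabulate (φ ∘ Fin.suc))) xor b)
                                       ≡⟨ cong (h (φ Fin.zero) (φ (fromℕ m)) xor_)
                                            (weight-not red h (λ a b → complement (c a b)) (φ Fin.zero) (tabulate (φ ∘ Fin.suc))) ⟨
    h (φ Fin.zero) (φ (fromℕ m)) xor weight h (tabulate φ)
                                       ≡⟨ isOdd-colourCount m 2≤m φ c i ⟨
    isOdd (colourCount (C (suc m)) φ c i) ≡⟨ odd ⟩
    true                               ∎
    where
    open ≡-Reasoning
    open xor-∧-Solver
    h = λ a b → does (c a b Fin.≟ i)
    a = red (φ Fin.zero) (φ (fromℕ m))
    b = weight red (tabulate φ)

  red-sym : ∀ u v → red u v ≡ red v u
  red-sym u v = cong (λ j → does (j Fin.≟ Fin.zero)) (Colouring.symm χ u v)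

  odd : ∀ {v z xs} → Path (λ a b → adj G a b ≡ true) v z xs → adj G z v ≡ true →
        xs ↭ allFin (suc m) → weight red xs xor red z v ≡ true
  odd {xs = xs} path zv eq
    with as-tabulate xs (trans (↭-length eq) (length-tabulate {n = suc m} (λ i → i)))
  ... | φ , refl with path-tabulate m φ path | oddCopies φ (cycle-isCopy G φ path zv eq)
  ... | refl , refl , _ | i , count-odd = begin
    weight red (tabulate φ) xor red (φ (fromℕ m)) (φ Fin.zero)
      ≡⟨ Bool.xor-comm (weight red (tabulate φ)) _ ⟩
    red (φ (fromℕ m)) (φ Fin.zero) xor weight red (tabulate φ)
      ≡⟨ cong (_xor weight red (tabulate φ)) (red-sym _ _) ⟩
    red (φ Fin.zero) (φ (fromℕ m)) xor weight red (tabulate φ)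
      ≡⟨ red-parity φ i (%2≡1⇒isOdd (colourCount (C (suc m)) φ c i) count-odd) ⟩
    true ∎
    where open ≡-Reasoning

  open EvenCycle G degrees
  open Odd red red-sym odd

-- Minimum degree and the lower bound.

count-tabulate : ∀ (p : A → Bool) {n} (f : Fin n → A) →
                 count p (tabulate f) ≡ ∣ Vec.tabulate (p ∘ f) ∣
count-tabulate p {zero}  f = refl
count-tabulate p {suc n} f with p (f Fin.zero)
... | false = count-tabulate p (f ∘ Fin.suc)
... | true  = cong suc (count-tabulate p (f ∘ Fin.suc))

foldr-⊓-≤ : ∀ {n} b (f : Fin n → ℕ) i → Vector.foldr _⊓_ b f ≤ f i
foldr-⊓-≤ b f Fin.zero    = ℕ.m⊓n≤m (f Fin.zero) _
foldr-⊓-≤ b f (Fin.suc i) = ℕ.≤-trans (ℕ.m⊓n≤n (f Fin.zero) _) (foldr-⊓-≤ b (f ∘ Fin.suc) i)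

three-colours-needed : ∀ {n} k → n ≡ k * 2 → 4 ≤ n → (G : Graph n) → k + 4 ≤ δ G →
                       ∀ r → HasOddColouring G (C n) r → 3 ≤ r
three-colours-needed {n} k n≡2k 4≤n G k+4≤δ = λ where
    zero (() , _)
    (suc zero) odd → contradiction odd (none one-colour)
    (suc (suc zero)) odd → contradiction odd (none two-colours)
    (suc (suc (suc r))) _ → s≤s (s≤s (s≤s z≤n))
  where
  k+4≤ : ∀ u → k + 4 ≤ count (adj G u) (allFin n)
  k+4≤ u = ℕ.≤-trans k+4≤δ (ℕ.≤-trans (foldr-⊓-≤ n (degree G) u)
             (ℕ.≤-reflexive (sym (count-tabulate (adj G u) (λ i → i)))))

  degrees : ∀ u v → n + 8 ≤ count (adj G u) (allFin n) + count (adj G v) (allFin n)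
  degrees u v = begin
    n + 8             ≡⟨ cong (_+ 8) n≡2k ⟩
    k * 2 + 8         ≡⟨ solve 1 (λ k → k :* con 2 :+ con 8 := (k :+ con 4) :+ (k :+ con 4)) refl k ⟩
    (k + 4) + (k + 4) ≤⟨ ℕ.+-mono-≤ (k+4≤ u) (k+4≤ v) ⟩
    count (adj G u) (allFin n) + count (adj G v) (allFin n) ∎
    where
    open ℕ.≤-Reasoning
    open +-*-Solver

  none : ∀ {r} → (∀ (i : Fin (suc r)) → ZeroOrComplement i) → ¬ HasOddColouring G (C n) (suc r)
  none = no-odd-colouring k n≡2k 4≤n G degrees

min-≥ : ∀ {P : Pred ℕ 0ℓ} {b} → (∀ j → P j → b ≤ j) → ∀ x → x IsMinOf P → [ b ] ≤∞ x
min-≥ bound [ k ] (Pk , _) = Supremum.[ bound k Pk ]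
min-≥ bound ⊤⁺    _        = _ Supremum.≤⊤⁺

theorem1p3 : (n : ℕ) → 2 ∣ n → 4 ≤ n →
    ([ 3 ] ≤∞ rOddMin n (n / 2 + 4) (C n)) ×
    ((G : Graph n) → n / 2 + 4 ≤ δ G → [ 3 ] ≤∞ rOdd G (C n))
theorem1p3 n (divides k n≡2k) 4≤n =
  min-≥ {RealisedWithMinDegree n (n / 2 + 4) (C n)} realised
    (rOddMin n (n / 2 + 4) (C n)) (rOddMin-isMin n (n / 2 + 4) (C n)) , each
  where
  n/2≡k : n / 2 ≡ k
  n/2≡k = trans (cong (_/ 2) n≡2k) (m*n/n≡m k 2)

  each : (G : Graph n) → n / 2 + 4 ≤ δ G → [ 3 ] ≤∞ rOdd G (C n)
  each G n/2+4≤δ = min-≥ {HasOddColouring G (C n)}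
    (three-colours-needed k n≡2k 4≤n G (subst (λ l → l + 4 ≤ δ G) n/2≡k n/2+4≤δ))
    (rOdd G (C n)) (rOdd-isMin G (C n))

  realised : ∀ r → RealisedWithMinDegree n (n / 2 + 4) (C n) r → 3 ≤ r
  -- The realised value `r` is `rOdd G (C n)` itself, so the bound for the single graph `G` carries
  -- over.
  realised r (G , n/2+4≤δ , eq) = [3]≤[ r ] (rOdd G (C n)) eq (each G n/2+4≤δ)
    where
    [3]≤[_] : ∀ r x → x ≡ [ r ] → [ 3 ] ≤∞ x → 3 ≤ r
    [3]≤[ r ] _ refl (Supremum.[ 3≤r ]) = 3≤r
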